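{- Co-inductive structural resolution is sound with respect to the greatest complete Herbrand model. That is: let $P$ be a logic program and let $G={\leftarrow A_1,\ldots,A_m}$ be a goal (identified with $\leftarrow (A_1,\emptyset),\ldots,(A_m,\emptyset)$). If $G$ has a co-S-refutation with respect to $P$ with computed substitution $\sigma$, then $G\sigma$ is in the greatest complete Herbrand model $\mathrm{gfp}(T'_P)$ of $P$, i.e. for every $i\in\{1,\ldots,m\}$ every ground instance (over the complete Herbrand universe) of $A_i\sigma$ belongs to $\mathrm{gfp}(T'_P)$.
   Context: Terms and atoms are first-order and may be infinite trees. A rational term (or atom) is a possibly infinite, possibly non-ground tree with only finitely many distinct subtrees. A substitution is a mapping $\{x_1/t_1,\ldots,x_n/t_n\}$ with $x_1,\ldots,x_n$ distinct variables, $t_1,\ldots,t_n$ rational terms, and no $x_i$ occurring in any $t_j$; $\epsilon$ is the empty substitution. Composition is the usual one: $E(\theta\eta)=(E\theta)\eta$. A unifier of rational terms/atoms $t_1,t_2$ is a substitution $\theta$ with $t_1\theta=t_2\theta$, written $t_1\sim_\theta t_2$ (unifiers are not required to be most general). If a unifier $\theta$ of $t_1,t_2$ also satisfies $t_1\theta=t_2$, it is called a matcher of $t_1$ against $t_2$, written $t_1\prec_\theta t_2$. A logic program $P$ is a finite set of definite clauses $B_0\leftarrow B_1,\ldots,B_m$ ($m\ge 0$) with finite atoms. Goals have the form $\leftarrow (A_1,S_1),\ldots,(A_n,S_n)$ where each $A_i$ is a (rational) atom and each $S_i$ is a finite set of atoms; the empty goal is $n=0$. Applying $\theta$ to a goal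 means applying it to every $A_i$ and to every member of every $S_i$. "Freshly renamed" means that the clause variables are renamed to variables not occurring in the current goal nor anywhere earlier in the derivation (including earlier unifiers). Co-inductive structural resolution (co-S-resolution): from $G={\leftarrow (A_1,S_1),\ldots,(A_n,S_n)}$ the next goal $G'$ is derived by one of: 1. (Rewriting reduction, rule-1) If a freshly renamed clause $B_0\leftarrow B_1,\ldots,B_m$ of $P$ satisfies $B_0\prec_\theta A_k$ for some $k$, then with $S'=S_k\cup\{A_k\}$, $G'={\leftarrow (A_1,S_1),\ldots,(A_{k-1},S_{k-1}),(B_1\theta,S'),\ldots,(B_m\theta,S'),(A_{k+1},S_{k+1}),\ldots,(A_n,S_n)}$. 2. (Substitution reduction, rule-2) If a freshly renamed clause $B_0\leftarrow B_1,\ldots,B_m$ of $P$ satisfies $B_0\sim_\theta A_k$ but not $B_0\prec_\theta A_k$ for some $k$, then $G'={\leftarrow \big((A_1,S_1),\ldots,(A_n,S_n)\big)\theta}$. 3. (Loop detection, rule-3) If $A_k\sim_\theta B$ for some $k$ and some $B\in S_k$, then $G'={\leftarrow \big((A_1,S_1),\ldots,(A_{k-1},S_{k-1}),(A_{k+1},S_{k+1}),\ldots,(A_n,S_n)\big)\theta}$. A co-S-derivation is a possibly infinite sequence of goals $G_0,G_1,\ldots$ with $G_0$ of the form $\leftarrow(A_1,\emptyset),\ldots,(A_m,\emptyset)$ ($m\ge 0$), each $G_{i+1}$ derived from $G_i$ by co-S-resolution, with no two consecutive uses of substitution reduction. A co-S-refutation is a finite co-S-derivation ending with the empty goal. Its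 computed substitution is the composition $\theta_1\theta_2\cdots\theta_n$ of the unifiers used in its rule-2 and rule-3 steps, in the order they were computed. The complete Herbrand universe is the set of all finite and infinite ground terms over the signature of $P$ (as usual assumed to contain at least one constant), and the complete Herbrand base $B'_P$ is the set of all ground atoms over it. The operator $T'_P:2^{B'_P}\to 2^{B'_P}$ is $T'_P(I)=\{A\in B'_P\mid A\leftarrow A_1,\ldots,A_n$ is a ground instance (over the complete Herbrand universe) of a clause in $P$ and $\{A_1,\ldots,A_n\}\subseteq I\}$. The greatest complete Herbrand model of $P$ is $\mathrm{gfp}(T'_P)=\bigcup\{I\mid I\subseteq T'_P(I)\}$. The goal is assumed to be over the same signature as $P$. -}

module Defs where

open import Data.Empty using (⊥)
open import Data.List.Base using (List; []; _∷_; _++_; _∷ʳ_; map)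
open import Data.List.Membership.Propositional using () renaming (_∈_ to _∈ᴸ_)
open import Data.List.Relation.Unary.All using (All)
open import Data.List.Relation.Unary.Any using (Any)
open import Data.List.Relation.Unary.Unique.Propositional using (Unique)
open import Data.Maybe using (Maybe; just; nothing; Is-just)
open import Data.Maybe.Relation.Unary.Any using (just)
open import Data.Nat.Base using (ℕ; _<_)
open import Data.Nat.Properties using (_≟_)
open import Data.Product.Base using (∃; _×_; _,_; proj₁; proj₂)
open import Data.Unit.Base using (⊤; tt)
open import Data.Vec.Base as Vec using (Vec)
open import Data.Vec.Relation.Binary.Pointwise.Inductive using (Pointwise)
open import Data.Vec.Relation.Unary.All as VecAll using ()
open import Data.Vec.Relation.Unary.Any as VecAny using ()
open import Function.Base using (_∘_)
open import Function.Bundles using (_⇔_; mk⇔; module Equivalence)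
open import Level using (0ℓ; suc)
open import Relation.Binary.Construct.Closure.ReflexiveTransitive using (Star; ε; _◅_)
open import Relation.Binary.PropositionalEquality using (_≡_; refl; sym; trans)
open import Relation.Nullary using (¬_; yes; no)
open import Relation.Unary using (Pred; _∈_; _∉_; _⊆_; _∪_; ∅)

record Signature : Set₁ where
  field
    Fun      : Set
    arity    : Fun → ℕ
    Rel      : Set
    arityᴿ   : Rel → ℕ
    constant : ∃ λ c → arity c ≡ 0

module SResolution (Sig : Signature) where
  open Signature Sig

  -- A term is a partial labelling of positions (words over ℕ, read from
  -- the root) by variables and function symbols: the root is labelled,
  -- and p has an i-th child exactly when p carries a function symbol of
  -- arity greater than i.

  data Label (V : Set) : Set where
    var : V → Label V
    fun : Fun → Label V

  Labelling : Set → Set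
  Labelling V = List ℕ → Maybe (Label V)

  ChildrenByArity : ∀ {V} → Labelling V → Set
  ChildrenByArity t = ∀ p i →
    Is-just (t (p ∷ʳ i)) ⇔ (∃ λ f → t p ≡ just (fun f) × i < arity f)

  record Term (V : Set) : Set where
    field
      label    : Labelling V
      root     : Is-just (label [])
      children : ChildrenByArity label

  open Term public

  infix 4 _≈_ _⊑_

  _≈_ : ∀ {V} → Term V → Term V → Set
  s ≈ t = ∀ p → label s p ≡ label t p

  _⊑_ : ∀ {V} → Term V → Term V → Set
  s ⊑ t = ∃ λ p → ∀ q → label s q ≡ label t (p ++ q)

  -- The list us covers the subterms of t up to _≈_; it may contain
  -- further terms.
  Rational : ∀ {V} → Pred (Term V) 0ℓ
  Rational t = ∃ λ us → ∀ s → s ⊑ t → Any (s ≈_) us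

  Finite : ∀ {V} → Pred (Term V) 0ℓ
  Finite t = ∃ λ ps → ∀ p → Is-just (label t p) → p ∈ᴸ ps

  Vars : ∀ {V} → Term V → Pred V 0ℓ
  Vars t x = ∃ λ p → label t p ≡ just (var x)

  ⟨_⟩ : ∀ {V} → V → Term V
  ⟨_⟩ {V} x = record { label = leaf ; root = just tt ; children = wf }
    where
    leaf : Labelling V
    leaf []      = just (var x)
    leaf (_ ∷ _) = nothing

    wf : ChildrenByArity leaf
    wf []      i = mk⇔ (λ ()) (λ { (_ , () , _) })
    wf (_ ∷ _) i = mk⇔ (λ ()) (λ { (_ , () , _) })

  graft : ∀ {V W} → Labelling V → (V → Term W) → Labelling W
  graft t σ p       with t []
  graft t σ p       | nothing      = nothing
  graft t σ p       | just (var x) = label (σ x) p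
  graft t σ []      | just (fun f) = just (fun f)
  graft t σ (i ∷ p) | just (fun f) = graft (λ q → t (i ∷ q)) σ p

  graft-root : ∀ {V W} (t : Labelling V) (σ : V → Term W) →
               Is-just (t []) ⇔ Is-just (graft t σ [])
  graft-root t σ with t []
  ... | nothing      = mk⇔ (λ ()) (λ ())
  ... | just (var x) = mk⇔ (λ _ → root (σ x)) (λ _ → just tt)
  ... | just (fun f) = mk⇔ (λ _ → just tt) (λ _ → just tt)

  graft-children : ∀ {V W} (t : Labelling V) (σ : V → Term W) →
                   ChildrenByArity t → ChildrenByArity (graft t σ)
  graft-children t σ wf p i with t [] in eq
  ... | nothing      = mk⇔ (λ ()) (λ { (_ , () , _) })
  ... | just (var x) = children (σ x) p i
  graft-children {V} {W} t σ wf [] i | just (fun f) = mk⇔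
    (λ d → label-fun (to (wf [] i) (from child d)))
    (λ { (_ , refl , i<n) → to child (from (wf [] i) (f , eq , i<n)) })
    where
    open Equivalence

    child : Is-just (t (i ∷ [])) ⇔ Is-just (graft (λ q → t (i ∷ q)) σ [])
    child = graft-root (λ q → t (i ∷ q)) σ

    label-fun : (∃ λ g → t [] ≡ just (fun g) × i < arity g) →
                ∃ λ g → just (fun {W} f) ≡ just (fun g) × i < arity g
    label-fun (g , eq′ , i<n) with trans (sym eq) eq′
    ... | refl = g , refl , i<n
  graft-children t σ wf (j ∷ p) i | just (fun f) =
    graft-children (λ q → t (j ∷ q)) σ (λ q → wf (j ∷ q)) p i

  infixl 20 _[_] _[_]ᴬ _[_]ᶜ _[_]ᴳ

  _[_] : ∀ {V W} → Term V → (V → Term W) → Term W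
  t [ σ ] = record
    { label    = graft (label t) σ
    ; root     = Equivalence.to (graft-root (label t) σ) (root t)
    ; children = graft-children (label t) σ (children t)
    }

  infixr 9 _⨾_

  _⨾_ : ∀ {U V W : Set} → (U → Term V) → (V → Term W) → U → Term W
  (σ ⨾ τ) x = σ x [ τ ]

  record Atom (V : Set) : Set where
    constructor atom
    field
      rel  : Rel
      args : Vec (Term V) (arityᴿ rel)

  open Atom public

  infix 4 _≈ᴬ_

  data _≈ᴬ_ {V} : Atom V → Atom V → Set where
    atom : ∀ {r ss ts} → Pointwise _≈_ ss ts → atom r ss ≈ᴬ atom r ts

  _[_]ᴬ : ∀ {V W} → Atom V → (V → Term W) → Atom W
  atom r ts [ σ ]ᴬ = atom r (Vec.map (_[ σ ]) ts)

  Rationalᴬ Finiteᴬ : ∀ {V} → Pred (Atom V) 0ℓ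
  Rationalᴬ A = VecAll.All Rational (args A)
  Finiteᴬ   A = VecAll.All Finite (args A)

  Varsᴬ : ∀ {V} → Atom V → Pred V 0ℓ
  Varsᴬ A x = VecAny.Any (λ t → x ∈ Vars t) (args A)

  infix 3 _⇐_

  record Clause (V : Set) : Set where
    constructor _⇐_
    field
      head : Atom V
      body : List (Atom V)

  open Clause public

  _[_]ᶜ : ∀ {V W} → Clause V → (V → Term W) → Clause W
  (B₀ ⇐ Bs) [ σ ]ᶜ = B₀ [ σ ]ᴬ ⇐ map (_[ σ ]ᴬ) Bs

  Varsᶜ : ∀ {V} → Clause V → Pred V 0ℓ
  Varsᶜ C x = Any (λ B → x ∈ Varsᴬ B) (head C ∷ body C)

  record Program : Set where
    field
      clauses : List (Clause ℕ)
      finite  : All (λ C → All Finiteᴬ (head C ∷ body C)) clauses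

  open Program public

  record Substitution : Set where
    field
      bindings : List (ℕ × Term ℕ)

    domain : List ℕ
    domain = map proj₁ bindings

    range : List (Term ℕ)
    range = map proj₂ bindings

    field
      distinct : Unique domain
      rational : All Rational range
      disjoint : All (λ x → All (λ t → x ∉ Vars t) range) domain

  open Substitution public

  lookup : List (ℕ × Term ℕ) → ℕ → Term ℕ
  lookup []             x = ⟨ x ⟩
  lookup ((y , t) ∷ bs) x with x ≟ y
  ... | yes _ = t
  ... | no  _ = lookup bs x

  ⟦_⟧ : Substitution → ℕ → Term ℕ
  ⟦ θ ⟧ = lookup (bindings θ)

  Varsˢ : Substitution → Pred ℕ 0ℓ
  Varsˢ θ = (_∈ᴸ domain θ) ∪ (λ x → Any (λ t → x ∈ Vars t) (range θ))

  infix 4 _∼[_]_ _≺[_]_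

  _∼[_]_ : Atom ℕ → Substitution → Atom ℕ → Set
  A ∼[ θ ] B = A [ ⟦ θ ⟧ ]ᴬ ≈ᴬ B [ ⟦ θ ⟧ ]ᴬ

  _≺[_]_ : Atom ℕ → Substitution → Atom ℕ → Set
  A ≺[ θ ] B = A ∼[ θ ] B × A [ ⟦ θ ⟧ ]ᴬ ≈ᴬ B

  -- The second component lists the finite set S of atoms.
  Goal : Set
  Goal = List (Atom ℕ × List (Atom ℕ))

  initial : List (Atom ℕ) → Goal
  initial = map (_, [])

  _[_]ᴳ : Goal → (ℕ → Term ℕ) → Goal
  G [ σ ]ᴳ = map (λ (A , S) → A [ σ ]ᴬ , map (_[ σ ]ᴬ) S) G

  Varsᴳ : Goal → Pred ℕ 0ℓ
  Varsᴳ G x = Any (λ (A , S) → Any (λ B → x ∈ Varsᴬ B) (A ∷ S)) G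

  -- Freshness depends on the whole derivation, so it is imposed there
  -- (see FreshAfter).
  record Variant (P : Program) : Set where
    field
      clause    : Clause ℕ
      clause∈P  : clause ∈ᴸ clauses P
      rename    : ℕ → ℕ
      injective : ∀ {x y} → x ∈ Varsᶜ clause → y ∈ Varsᶜ clause →
                  rename x ≡ rename y → x ≡ y

    variant : Clause ℕ
    variant = clause [ ⟨_⟩ ∘ rename ]ᶜ

  open Variant public

  infix 4 _⊢_⟶_

  data _⊢_⟶_ (P : Program) : Goal → Goal → Set where

    rewriting : ∀ {L A S R} (C : Variant P) θ →
      head (variant C) ≺[ θ ] A →
      P ⊢ L ++ (A , S) ∷ R
        ⟶ L ++ map (λ B → B [ ⟦ θ ⟧ ]ᴬ , A ∷ S) (body (variant C)) ++ R

    substitution : ∀ {L A S R} (C : Variant P) θ →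
      head (variant C) ∼[ θ ] A →
      ¬ head (variant C) ≺[ θ ] A →
      P ⊢ L ++ (A , S) ∷ R
        ⟶ (L ++ (A , S) ∷ R) [ ⟦ θ ⟧ ]ᴳ

    loop : ∀ {L A S R B} θ →
      B ∈ᴸ S →
      A ∼[ θ ] B →
      P ⊢ L ++ (A , S) ∷ R
        ⟶ (L ++ R) [ ⟦ θ ⟧ ]ᴳ

  module _ {P : Program} where

    IsSubstitution : ∀ {G G′} → P ⊢ G ⟶ G′ → Set
    IsSubstitution (rewriting _ _ _)      = ⊥
    IsSubstitution (substitution _ _ _ _) = ⊤
    IsSubstitution (loop _ _ _)           = ⊥

    unifier : ∀ {G G′} → P ⊢ G ⟶ G′ → Substitution
    unifier (rewriting _ θ _)      = θ
    unifier (substitution _ θ _ _) = θ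
    unifier (loop θ _ _)           = θ

    VariantVars : ∀ {G G′} → P ⊢ G ⟶ G′ → Pred ℕ 0ℓ
    VariantVars (rewriting C _ _)      = Varsᶜ (variant C)
    VariantVars (substitution C _ _ _) = Varsᶜ (variant C)
    VariantVars (loop _ _ _)           = ∅

    -- Matchers of rewriting steps do not contribute.
    answer : ∀ {G G′} → P ⊢ G ⟶ G′ → ℕ → Term ℕ
    answer (rewriting _ _ _)      = ⟨_⟩
    answer (substitution _ θ _ _) = ⟦ θ ⟧
    answer (loop θ _ _)           = ⟦ θ ⟧

    -- U collects the variables used so far.
    FreshAfter : ∀ {G G′} → Pred ℕ 0ℓ → Star (P ⊢_⟶_) G G′ → Set
    FreshAfter U ε = ⊤
    FreshAfter U (_◅_ {i = G} s D) =
      (∀ {x} → x ∈ VariantVars s → x ∉ U ∪ Varsᴳ G) ×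
      FreshAfter (U ∪ Varsᴳ G ∪ VariantVars s ∪ Varsˢ (unifier s)) D

    NoConsecutiveSubstitutions : ∀ {G G′} → Star (P ⊢_⟶_) G G′ → Set
    NoConsecutiveSubstitutions ε           = ⊤
    NoConsecutiveSubstitutions (s ◅ ε)     = ⊤
    NoConsecutiveSubstitutions (s ◅ t ◅ D) =
      ¬ (IsSubstitution s × IsSubstitution t) ×
      NoConsecutiveSubstitutions (t ◅ D)

    compose : ∀ {G G′} → Star (P ⊢_⟶_) G G′ → ℕ → Term ℕ
    compose ε       = ⟨_⟩
    compose (s ◅ D) = answer s ⨾ compose D

  -- Only finite derivations are represented, as only these can be
  -- refutations.  Rationality has to be assumed of the initial atoms
  -- only: instantiation by substitutions preserves it.
  record CoSDerivation (P : Program) (As : List (Atom ℕ)) (G : Goal) : Set where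
    field
      steps         : Star (P ⊢_⟶_) (initial As) G
      freshVariants : FreshAfter ∅ steps
      noConsecutive : NoConsecutiveSubstitutions steps

  CoSRefutation : Program → List (Atom ℕ) → Set
  CoSRefutation P As = CoSDerivation P As []

  -- A composition of substitutions need not satisfy the disjointness
  -- condition on bindings, so it is just a map from variables to terms.
  computed : ∀ {P As} → CoSRefutation P As → ℕ → Term ℕ
  computed D = compose (CoSDerivation.steps D)

  GroundTerm GroundAtom : Set
  GroundTerm = Term ⊥
  GroundAtom = Atom ⊥

  -- γ instantiates all variables, not just those of C; since there is a
  -- constant, every ground instance arises in this way.
  T′ : Program → Pred GroundAtom 0ℓ → Pred GroundAtom 0ℓ
  T′ P I A = ∃ λ C → C ∈ᴸ clauses P × ∃ λ (γ : ℕ → GroundTerm) →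
    A ≈ᴬ head (C [ γ ]ᶜ) × All I (body (C [ γ ]ᶜ))

  -- I ranges over all predicates, including those not closed under ≈ᴬ;
  -- the union is unchanged, since the ≈ᴬ-closure of a post-fixed point
  -- of T′ P is again one.
  gfpT′ : Program → Pred GroundAtom (suc 0ℓ)
  gfpT′ P A = ∃ λ (I : Pred GroundAtom 0ℓ) → I ⊆ T′ P I × A ∈ I

-- Fix a ground substitution γ and instantiate each atom of the refutation by
-- the answer computed from there on, followed by γ.  The instances of the atoms
-- reduced by rule 1 form a post-fixed point of T′: each is the head of a ground
-- clause instance, and a body atom is eventually either reduced by rule 1 itself
-- or removed by rule 3, in which case its instance equals that of an atom in S,
-- that is, of one reduced by rule 1 earlier.

module Submission where

open import Defs
open import Data.List.Base using (List; []; _∷_; _++_; map)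
open import Data.List.Membership.Propositional using (_∈_)
open import Data.List.Relation.Unary.All as All using (All; []; _∷_)
open import Data.List.Relation.Unary.All.Properties using (++⁺; ++⁻ˡ; ++⁻ʳ; map⁺; map⁻)
open import Data.Maybe.Base using (just; nothing)
open import Data.Nat.Base using (ℕ)
open import Data.Product.Base using (_×_; _,_; proj₁; proj₂)
open import Data.Sum.Base using (inj₁; inj₂; [_,_]′)
open import Data.Vec.Relation.Binary.Pointwise.Inductive as Pointwise using (Pointwise; []; _∷_)
open import Data.Vec.Base as Vec using (Vec; []; _∷_)
open import Function.Base using (_∘_; id)
open import Level using (0ℓ)
open import Relation.Binary.Construct.Closure.ReflexiveTransitive using (Star; ε; _◅_)
open import Relation.Binary.PropositionalEquality using (_≡_; refl; sym; trans)
open import Relation.Unary using (Pred; _⊆_; _∪_; ∅)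

module _ (Sig : Signature) where
  open Signature Sig
  open SResolution Sig

  -- Grafting and composition of substitutions.

  module _ {V W : Set} (t : Labelling V) (σ : V → Term W) where

    -- `graft` branches on the root label of `t`. These lemmas give its clauses for a root known
    -- only up to a propositional equation.
    graft-nothing : t [] ≡ nothing → ∀ p → graft t σ p ≡ nothing
    graft-nothing eq p with t [] | eq
    ... | _ | refl = refl

    graft-var : ∀ {x} → t [] ≡ just (var x) → ∀ p → graft t σ p ≡ label (σ x) p
    graft-var eq p with t [] | eq
    ... | _ | refl = refl

    graft-fun-[] : ∀ {f} → t [] ≡ just (fun f) → graft t σ [] ≡ just (fun f)
    graft-fun-[] eq with t [] | eq
    ... | _ | refl = refl

    graft-fun-∷ : ∀ {f} → t [] ≡ just (fun f) →
                  ∀ i p → graft t σ (i ∷ p) ≡ graft (λ q → t (i ∷ q)) σ p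
    graft-fun-∷ eq i p with t [] | eq
    ... | _ | refl = refl

  graft-cong : ∀ {V W} {t u : Labelling V} {σ τ : V → Term W} →
               (∀ p → t p ≡ u p) → (∀ x → σ x ≈ τ x) →
               ∀ p → graft t σ p ≡ graft u τ p
  graft-cong {t = t} {u} t≗u σ≈τ p with t [] | u [] | t≗u []
  graft-cong t≗u σ≈τ p       | nothing      | _ | refl = refl
  graft-cong t≗u σ≈τ p       | just (var x) | _ | refl = σ≈τ x p
  graft-cong t≗u σ≈τ []      | just (fun f) | _ | refl = refl
  graft-cong t≗u σ≈τ (i ∷ p) | just (fun f) | _ | refl =
    graft-cong (λ q → t≗u (i ∷ q)) σ≈τ p

  graft-⨾ : ∀ {U V W} (t : Labelling U) (σ : U → Term V) (τ : V → Term W) →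
            ∀ p → graft (graft t σ) τ p ≡ graft t (σ ⨾ τ) p
  graft-⨾ t σ τ p = at-root p (t []) refl
    where
    at-root : ∀ p l → t [] ≡ l → graft (graft t σ) τ p ≡ graft t (σ ⨾ τ) p
    at-root p nothing eq =
      trans (graft-nothing (graft t σ) τ (graft-nothing t σ eq []) p)
        (sym (graft-nothing t (σ ⨾ τ) eq p))
    at-root p (just (var x)) eq =
      trans (graft-cong (graft-var t σ eq) (λ _ _ → refl) p)
        (sym (graft-var t (σ ⨾ τ) eq p))
    at-root [] (just (fun f)) eq =
      trans (graft-fun-[] (graft t σ) τ (graft-fun-[] t σ eq))
        (sym (graft-fun-[] t (σ ⨾ τ) eq))
    at-root (i ∷ p) (just (fun f)) eq =
      trans (graft-fun-∷ (graft t σ) τ (graft-fun-[] t σ eq) i p)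
        -- The child of `graft t σ` at `i` agrees with the grafted child of `t` only pointwise,
        -- hence the congruence.
        (trans (graft-cong (graft-fun-∷ t σ eq i) (λ _ _ → refl) p)
          (trans (graft-⨾ (λ q → t (i ∷ q)) σ τ p)
            (sym (graft-fun-∷ t (σ ⨾ τ) eq i p))))

  -- Equality and instances of atoms.

  ≈ᴬ-refl : ∀ {V} {A : Atom V} → A ≈ᴬ A
  ≈ᴬ-refl = atom (Pointwise.refl (λ _ → refl))

  ≈ᴬ-sym : ∀ {V} {A B : Atom V} → A ≈ᴬ B → B ≈ᴬ A
  ≈ᴬ-sym (atom ss≈ts) = atom (Pointwise.sym (λ s≈t p → sym (s≈t p)) ss≈ts)

  ≈ᴬ-trans : ∀ {V} {A B C : Atom V} → A ≈ᴬ B → B ≈ᴬ C → A ≈ᴬ C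
  ≈ᴬ-trans (atom ss≈ts) (atom ts≈us) =
    atom (Pointwise.trans (λ s≈t t≈u p → trans (s≈t p) (t≈u p)) ss≈ts ts≈us)

  []ᴬ-cong : ∀ {V W} {A B : Atom V} {σ τ : V → Term W} →
             A ≈ᴬ B → (∀ x → σ x ≈ τ x) → A [ σ ]ᴬ ≈ᴬ B [ τ ]ᴬ
  []ᴬ-cong (atom ss≈ts) σ≈τ =
    atom (Pointwise.map⁺ (λ s≈t → graft-cong s≈t σ≈τ) ss≈ts)

  []ᴬ-congˡ : ∀ {V W} {A B : Atom V} (σ : V → Term W) →
              A ≈ᴬ B → A [ σ ]ᴬ ≈ᴬ B [ σ ]ᴬ
  []ᴬ-congˡ σ A≈B = []ᴬ-cong A≈B (λ _ _ → refl)

  []ᴬ-⨾ : ∀ {U V W} (A : Atom U) (σ : U → Term V) (τ : V → Term W) →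
          A [ σ ]ᴬ [ τ ]ᴬ ≈ᴬ A [ σ ⨾ τ ]ᴬ
  []ᴬ-⨾ (atom r ts) σ τ = atom (go ts)
    where
    go : ∀ {n} (ts : Vec (Term _) n) →
         Pointwise _≈_ (Vec.map (_[ τ ]) (Vec.map (_[ σ ]) ts))
                       (Vec.map (_[ σ ⨾ τ ]) ts)
    go []       = []
    go (t ∷ ts) = graft-⨾ (label t) σ τ ∷ go ts

  -- Closure under `≈ᴬ` and the operator `T′`.

  Respects≈ᴬ : Pred GroundAtom 0ℓ → Set
  Respects≈ᴬ I = ∀ {A B} → A ≈ᴬ B → I B → I A

  ∪-respects : ∀ {I J} → Respects≈ᴬ I → Respects≈ᴬ J → Respects≈ᴬ (I ∪ J)
  ∪-respects I-resp J-resp A≈B =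
    [ (λ B∈I → inj₁ (I-resp A≈B B∈I)) , (λ B∈J → inj₂ (J-resp A≈B B∈J)) ]′

  T′-respects : ∀ P I → Respects≈ᴬ (T′ P I)
  T′-respects P I A≈B (C , C∈P , γ , B≈head , body⊆I) =
    C , C∈P , γ , ≈ᴬ-trans A≈B B≈head , body⊆I

  T′-mono : ∀ P {I J} → I ⊆ J → T′ P I ⊆ T′ P J
  T′-mono P I⊆J (C , C∈P , γ , A≈head , body⊆I) =
    C , C∈P , γ , A≈head , All.map I⊆J body⊆I

  -- Renaming, unifier and grounding compose to a single ground substitution for `C`. The
  -- composition law holds only up to `≈ᴬ`, so `I` has to respect it.
  T′-instance : ∀ P {I} → Respects≈ᴬ I → ∀ {C V W} → C ∈ clauses P →
    (ρ : ℕ → Term V) (θ : V → Term W) (τ : W → GroundTerm) →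
    All (λ B → I (B [ θ ]ᴬ [ τ ]ᴬ)) (body (C [ ρ ]ᶜ)) →
    T′ P I (head (C [ ρ ]ᶜ) [ θ ]ᴬ [ τ ]ᴬ)
  T′-instance P I-resp {C} C∈P ρ θ τ body⊆I =
    C , C∈P , (ρ ⨾ θ) ⨾ τ , assoc (head C) ,
    map⁺ (All.map (λ {B} → I-resp (≈ᴬ-sym (assoc B))) (map⁻ body⊆I))
    where
    assoc : ∀ A → A [ ρ ]ᴬ [ θ ]ᴬ [ τ ]ᴬ ≈ᴬ A [ (ρ ⨾ θ) ⨾ τ ]ᴬ
    assoc A = ≈ᴬ-trans ([]ᴬ-congˡ τ ([]ᴬ-⨾ A ρ θ)) ([]ᴬ-⨾ A (ρ ⨾ θ) τ)

  -- Ground instances along a refutation.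

  module _ (P : Program) (γ : ℕ → GroundTerm) where

    Refutation : Goal → Set
    Refutation G = Star (P ⊢_⟶_) G []

    ground : ∀ {G} → Refutation G → Atom ℕ → GroundAtom
    ground D A = A [ compose D ]ᴬ [ γ ]ᴬ

    ground-cong : ∀ {G} (D : Refutation G) {A B} → A ≈ᴬ B → ground D A ≈ᴬ ground D B
    ground-cong D A≈B = []ᴬ-congˡ γ ([]ᴬ-congˡ (compose D) A≈B)

    ground-◅ : ∀ {G H} (s : P ⊢ G ⟶ H) (D : Refutation H) A →
               ground (s ◅ D) A ≈ᴬ ground D (A [ answer s ]ᴬ)
    ground-◅ s D A = []ᴬ-congˡ γ (≈ᴬ-sym ([]ᴬ-⨾ A (answer s) (compose D)))

    -- Each rewriting step contributes a whole `≈ᴬ`-class, so the set respects `≈ᴬ`.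
    Rewritten : ∀ {G} → Refutation G → Pred GroundAtom 0ℓ
    Rewritten ε = ∅
    Rewritten (s@(rewriting {A = A} _ _ _) ◅ D) = (_≈ᴬ ground (s ◅ D) A) ∪ Rewritten D
    Rewritten (substitution _ _ _ _ ◅ D) = Rewritten D
    Rewritten (loop _ _ _ ◅ D) = Rewritten D

    Rewritten-respects : ∀ {G} (D : Refutation G) → Respects≈ᴬ (Rewritten D)
    Rewritten-respects ε A≈B ()
    Rewritten-respects (rewriting _ _ _ ◅ D) =
      ∪-respects ≈ᴬ-trans (Rewritten-respects D)
    Rewritten-respects (substitution _ _ _ _ ◅ D) = Rewritten-respects D
    Rewritten-respects (loop _ _ _ ◅ D) = Rewritten-respects D

    -- `Ancestors` is an invariant carried forward along the derivation; `Selected` is a conclusion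
    -- carried back from its end.
    Selected Ancestors : Pred GroundAtom 0ℓ → ∀ {G} → Refutation G → Pred Goal 0ℓ
    Selected  I D = All (λ (A , _) → I (ground D A))
    Ancestors J D = All (λ (_ , S) → All (λ B → J (ground D B)) S)

    module _ {G H} (s : P ⊢ G ⟶ H) (D : Refutation H) {I} (I-resp : Respects≈ᴬ I) where

      Ancestors-answer : ∀ K → Ancestors I (s ◅ D) K → Ancestors I D (K [ answer s ]ᴳ)
      Ancestors-answer K ancs = map⁺
        (All.map (λ S⊆I → map⁺ (All.map (λ {B} → I-resp (≈ᴬ-sym (ground-◅ s D B))) S⊆I)) ancs)

      Selected-answer : ∀ K → Selected I D (K [ answer s ]ᴳ) → Selected I (s ◅ D) K
      Selected-answer K sels =
        All.map (λ {(A , _)} → I-resp (ground-◅ s D A)) (map⁻ sels)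

    -- J stands for the atoms rewritten before D: the refutation of a goal that
    -- occurs midway may close loops through them.
    Rewritten-postfixed : ∀ {G} (D : Refutation G) {J} → Respects≈ᴬ J → Ancestors J D G →
      Selected (Rewritten D ∪ J) D G × Rewritten D ⊆ T′ P (Rewritten D ∪ J)
    Rewritten-postfixed ε J-resp ancs = [] , λ ()
    Rewritten-postfixed (s@(substitution {L} {A} {S} {R} _ _ _ _) ◅ D) J-resp ancs
      with sels , post ← Rewritten-postfixed D J-resp
                           (Ancestors-answer s D J-resp (L ++ (A , S) ∷ R) ancs) =
      Selected-answer s D (∪-respects (Rewritten-respects D) J-resp) _ sels , post
    Rewritten-postfixed (s@(loop {L} {A} {S} {R} {B} θ B∈S Aθ≈Bθ) ◅ D) {J} J-resp ancs
      with S⊆J ∷ ancsR ← ++⁻ʳ L ancs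
      with sels , post ← Rewritten-postfixed D J-resp
                           (Ancestors-answer s D J-resp (L ++ R) (++⁺ (++⁻ˡ L ancs) ancsR)) =
      -- The removed atom lies in `J`: the unifier is part of the answer, so the ground instances of
      -- `A` and `B` coincide, and `B` is an ancestor.
      ++⁺ (++⁻ˡ L sels′) (inj₂ (J-resp A≈B (All.lookup S⊆J B∈S)) ∷ ++⁻ʳ L sels′) , post
      where
      sels′ : Selected (Rewritten D ∪ J) (s ◅ D) (L ++ R)
      sels′ = Selected-answer s D (∪-respects (Rewritten-respects D) J-resp) (L ++ R) sels

      A≈B : ground (s ◅ D) A ≈ᴬ ground (s ◅ D) B
      A≈B = ≈ᴬ-trans (ground-◅ s D A)
              (≈ᴬ-trans (ground-cong D Aθ≈Bθ) (≈ᴬ-sym (ground-◅ s D B)))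
    -- Matching is essential here: `θ` stays out of the answer, so the clause head under `θ` must
    -- equal `A` itself.
    Rewritten-postfixed (s@(rewriting {L} {A} {S} {R} C θ (_ , headθ≈A)) ◅ D) {J} J-resp ancs =
      ++⁺ (weaken (++⁻ˡ L sels)) (inj₁ (inj₁ ≈ᴬ-refl) ∷ weaken (++⁻ʳ Bs (++⁻ʳ L sels))) , post
      where
      Bs : Goal
      Bs = map (λ B → B [ ⟦ θ ⟧ ]ᴬ , A ∷ S) (body (variant C))

      -- Later loops may close through `A`, so its class joins the history.
      J′ : Pred GroundAtom 0ℓ
      J′ = (_≈ᴬ ground (s ◅ D) A) ∪ J

      J′-resp : Respects≈ᴬ J′
      J′-resp = ∪-respects ≈ᴬ-trans J-resp

      -- The answer of `s` is `⟨_⟩`, and grafting onto a variable leaf computes.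
      ground-s : ∀ B → ground (s ◅ D) B ≈ᴬ ground D B
      ground-s B = []ᴬ-congˡ γ ([]ᴬ-cong ≈ᴬ-refl (λ _ _ → refl))

      old : ∀ {K} → Ancestors J (s ◅ D) K → Ancestors J′ D K
      old = All.map (All.map (λ {B} B∈J → J′-resp (≈ᴬ-sym (ground-s B)) (inj₂ B∈J)))

      ancsS : All (λ B → J′ (ground D B)) S
      ancsS = All.head (old (++⁻ʳ L ancs))

      ancs′ : Ancestors J′ D (L ++ Bs ++ R)
      ancs′ = ++⁺ (old (++⁻ˡ L ancs))
        (++⁺ (map⁺ (All.universal (λ _ → inj₁ (≈ᴬ-sym (ground-s A)) ∷ ancsS) _))
             (old (All.tail (++⁻ʳ L ancs))))

      ih : Selected (Rewritten D ∪ J′) D (L ++ Bs ++ R) ×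
           Rewritten D ⊆ T′ P (Rewritten D ∪ J′)
      ih = Rewritten-postfixed D J′-resp ancs′

      sels : Selected (Rewritten D ∪ J′) D (L ++ Bs ++ R)
      sels = proj₁ ih

      I : Pred GroundAtom 0ℓ
      I = Rewritten (s ◅ D) ∪ J

      I-resp : Respects≈ᴬ I
      I-resp = ∪-respects (Rewritten-respects (s ◅ D)) J-resp

      -- The class of `A` passes from the history of `D` to the atoms rewritten in `s ◅ D`.
      regroup : Rewritten D ∪ J′ ⊆ I
      regroup = [ inj₁ ∘ inj₂ , [ inj₁ ∘ inj₁ , inj₂ ]′ ]′

      weaken : ∀ {K} → Selected (Rewritten D ∪ J′) D K → Selected I (s ◅ D) K
      weaken = All.map (λ {(B , _)} B∈ → I-resp (ground-s B) (regroup B∈))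

      bodyI : All (λ B → I (B [ ⟦ θ ⟧ ]ᴬ [ compose D ⨾ γ ]ᴬ)) (body (variant C))
      bodyI = All.map
        (λ {B} B∈ → I-resp (≈ᴬ-sym ([]ᴬ-⨾ (B [ ⟦ θ ⟧ ]ᴬ) (compose D) γ)) (regroup B∈))
        (map⁻ (++⁻ˡ Bs (++⁻ʳ L sels)))

      A≈head : ground (s ◅ D) A ≈ᴬ head (variant C) [ ⟦ θ ⟧ ]ᴬ [ compose D ⨾ γ ]ᴬ
      A≈head = ≈ᴬ-trans (ground-s A)
        (≈ᴬ-trans (ground-cong D (≈ᴬ-sym headθ≈A))
          ([]ᴬ-⨾ (head (variant C) [ ⟦ θ ⟧ ]ᴬ) (compose D) γ))

      post : Rewritten (s ◅ D) ⊆ T′ P I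
      -- The body atoms belong to the next goal, so the induction hypothesis puts their instances in
      -- `I`.
      post (inj₁ X≈A) = T′-respects P I (≈ᴬ-trans X≈A A≈head)
        (T′-instance P I-resp (clause∈P C) _ ⟦ θ ⟧ (compose D ⨾ γ) bodyI)
      post (inj₂ X∈D) = T′-mono P regroup (proj₂ ih X∈D)

theorem2 : (Sig : Signature) → let open SResolution Sig in
    (P : Program) (As : List (Atom ℕ)) → All Rationalᴬ As → (D : CoSRefutation P As) →
    ∀ {A} → A ∈ As → (γ : ℕ → GroundTerm) →
    gfpT′ P (A [ computed D ]ᴬ [ γ ]ᴬ)
theorem2 Sig P As _ D A∈As γ =
  I , (λ X∈I → T′-mono Sig P drop∅ (proj₂ postfixed X∈I)) ,
  drop∅ (All.lookup (map⁻ (proj₁ postfixed)) A∈As)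
  where
  open SResolution Sig
  open CoSDerivation D using (steps)

  I : Pred GroundAtom 0ℓ
  I = Rewritten Sig P γ steps

  -- The initial atoms have no ancestors, so the history is empty and `I` by itself is a post-fixed
  -- point.
  drop∅ : I ∪ ∅ ⊆ I
  drop∅ = [ id , (λ ()) ]′

  postfixed : Selected Sig P γ (I ∪ ∅) steps (initial As) × I ⊆ T′ P (I ∪ ∅)
  postfixed =
    Rewritten-postfixed Sig P γ steps (λ _ ()) (map⁺ (All.universal (λ _ → []) As))
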